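{- $$\sum_{\pi\in\mathcal{E}_O^{N}}q^{|\pi|}=\sum_{m\geq1}\frac{1}{(q;q)_m} \left[q^m+\sum_{k=1}^{m-1}q^{km-\binom{k}{2}}\right].$$
   Context: An overpartition is a finite non-increasing sequence of positive integers (its parts) in which the first occurrence of each number may be overlined (so for each size $t$ at most one part of size $t$ is overlined); the size of a part $t$ or $\overline{t}$ is $t$, and the weight $|\pi|$ is the sum of the sizes of the parts. $\mathcal{E}_O^{N}$ is the set of overpartitions in which at least one non-overlined part appears and the sizes of all non-overlined parts are greater than or equal to the sizes of all overlined parts (if any). Here $|q|<1$ (or $q$ is a formal variable), $(q;q)_m=\prod_{i=1}^{m}(1-q^i)$. -}

module Defs where

import Algebra.Properties.Semiring.Sum
open import Data.Bool.Base using (if_then_else_)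
open import Data.Fin.Base using (Fin; zero; suc; toℕ)
open import Data.Integer.Base as ℤ using (ℤ; 0ℤ; 1ℤ)
import Data.Integer.Properties as ℤ
import Data.Nat.Properties as ℕ
open import Data.List.Base using (List; foldr; map)
open import Data.List.Membership.Propositional using (_∈_; _∉_)
open import Data.List.Relation.Unary.All using (All)
open import Data.List.Relation.Unary.AllPairs using (AllPairs)
open import Data.List.Relation.Unary.Any using (Any)
open import Data.List.Relation.Unary.Linked using (Linked)
open import Data.List.Relation.Unary.Unique.Propositional using (Unique)
open import Data.Nat.Base as ℕ using (ℕ; zero; suc; _∸_)
open import Data.Nat.ListAction using (sum)
open import Data.Product.Base using (∃; _×_)
open import Data.Vec.Base using (Vec; _∷_; []; head; lookup)
open import Relation.Binary.PropositionalEquality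
open import Relation.Nullary.Decidable using (does)

module ℤΣ = Algebra.Properties.Semiring.Sum ℤ.+-*-semiring

-- Formal power series in q over ℤ: f n is the coefficient of qⁿ.
Series : Set
Series = ℕ → ℤ

infix  4 _≈_
infixl 6 _⊕_ _⊖_
infixl 7 _⊛_
infix  8 q^_

_≈_ : Series → Series → Set
f ≈ g = ∀ n → f n ≡ g n

q^_ : ℕ → Series
(q^ k) n = if does (k ℕ.≟ n) then 1ℤ else 0ℤ

0# 1# : Series
0# _ = 0ℤ
1# = q^ 0

_⊕_ _⊖_ _⊛_ : Series → Series → Series
(f ⊕ g) n = f n ℤ.+ g n
(f ⊖ g) n = f n ℤ.- g n
(f ⊛ g) n = ℤΣ.sum {suc n} λ i → f (toℕ i) ℤ.* g (n ∸ toℕ i)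

-- ∑₁ n f = f 1 ⊕ ⋯ ⊕ f n and ∏₁ n f = f 1 ⊛ ⋯ ⊛ f n.
∑₁ ∏₁ : ℕ → (ℕ → Series) → Series
∑₁ zero    f = 0#
∑₁ (suc n) f = ∑₁ n f ⊕ f (suc n)
∏₁ zero    f = 1#
∏₁ (suc n) f = ∏₁ n f ⊛ f (suc n)

-- For f with f 0 ≡ 1, the reciprocal g of f is determined by g 0 = 1 and
-- g (n + 1) = - ∑_{j ≤ n} f (j + 1) g (n - j).
-- recipCoeffs f n lists g n, …, g 1, g 0.
recipCoeffs : Series → (n : ℕ) → Vec ℤ (suc n)
recipCoeffs f zero    = 1ℤ ∷ []
recipCoeffs f (suc n) =
  ℤ.- ℤΣ.sum {suc n} (λ j → f (suc (toℕ j)) ℤ.* lookup gs j) ∷ gs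
  where gs = recipCoeffs f n

-- The multiplicative inverse of f, provided that f 0 ≡ 1 (see recip-inverseʳ);
-- no meaning is attached to it otherwise.
recip : Series → Series
recip f n = head (recipCoeffs f n)

lookup-recipCoeffs : ∀ f n (j : Fin (suc n)) →
                     lookup (recipCoeffs f n) j ≡ recip f (n ∸ toℕ j)
lookup-recipCoeffs f zero    zero    = refl
lookup-recipCoeffs f (suc n) zero    = refl
lookup-recipCoeffs f (suc n) (suc j) = lookup-recipCoeffs f n j

recip-inverseʳ : ∀ f → f 0 ≡ 1ℤ → f ⊛ recip f ≈ 1#
recip-inverseʳ f f₀≡1 zero    rewrite f₀≡1 = refl
recip-inverseʳ f f₀≡1 (suc n) = begin
  f 0 ℤ.* (ℤ.- s) ℤ.+ ℤΣ.sum {suc n} (λ j → f (suc (toℕ j)) ℤ.* recip f (n ∸ toℕ j))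
    ≡⟨ cong₂ ℤ._+_
         (trans (cong (ℤ._* (ℤ.- s)) f₀≡1) (ℤ.*-identityˡ (ℤ.- s)))
         (ℤΣ.sum-cong-≗ {suc n} λ j → cong (f (suc (toℕ j)) ℤ.*_)
           (sym (lookup-recipCoeffs f n j))) ⟩
  ℤ.- s ℤ.+ s
    ≡⟨ ℤ.+-inverseˡ s ⟩
  0ℤ ∎
  where
  open ≡-Reasoning
  s = ℤΣ.sum {suc n} (λ j → f (suc (toℕ j)) ℤ.* lookup (recipCoeffs f n) j)

-- (q;q)_m
qPoch : ℕ → Series
qPoch m = ∏₁ m λ i → 1# ⊖ q^ i

qPoch-constant : ∀ m → qPoch m 0 ≡ 1ℤ
qPoch-constant zero    = refl
qPoch-constant (suc m) rewrite qPoch-constant m = refl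

qPoch-inverseʳ : ∀ m → qPoch m ⊛ recip (qPoch m) ≈ 1#
qPoch-inverseʳ m = recip-inverseʳ (qPoch m) (qPoch-constant m)

-- SumsTo P F S says that the possibly infinite, unordered sum of the series
-- F i over all indices i satisfying P exists as a formal power series and
-- equals S: for each n only finitely many of these F i contribute to the
-- coefficient of qⁿ, and their contributions add up to S n.
SumsTo : {I : Set} → (I → Set) → (I → Series) → Series → Set
SumsTo {I} P F S = ∀ n → ∃ λ (is : List I) →
  Unique is ×
  All P is ×
  (∀ i → P i → i ∉ is → F i n ≡ 0ℤ) ×
  S n ≡ foldr ℤ._+_ 0ℤ (map (λ i → F i n) is)

data Part : Set where
  plain overlined : ℕ → Part

size : Part → ℕ
size (plain t)     = t
size (overlined t) = t

data Plain : Part → Set where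
  plain : ∀ {t} → Plain (plain t)

data Overlined : Part → Set where
  overlined : ∀ {t} → Overlined (overlined t)

weight : List Part → ℕ
weight π = sum (map size π)

record IsOverpartition (π : List Part) : Set where
  field
    positive      : All (λ p → 1 ℕ.≤ size p) π
    nonIncreasing : Linked (λ p r → size p ℕ.≥ size r) π
    -- p ranges over the parts that precede r, so an overlined r is the first
    -- occurrence of its size.
    overlineFirst : AllPairs (λ p r → Overlined r → size p ≢ size r) π

-- Membership in the set 𝓔_O^N.
record EON (π : List Part) : Set where
  field
    isOverpartition : IsOverpartition π
    somePlain       : Any Plain π
    plain≥overlined : ∀ {p r} → p ∈ π → r ∈ π → Plain p → Overlined r →
                      size p ℕ.≥ size r

{-# OPTIONS --safe #-}

-- Read from the smallest part upwards, the sizes of an overpartition in 𝓔_O^N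
-- with m parts, j ≥ 1 of them overlined, satisfy
-- 0 < b₁ < ⋯ < b_j ≤ a₁ ≤ ⋯ ≤ a_(m-j): the j smallest belong to the overlined
-- parts.  Conversely, such sizes together with j < m determine the
-- overpartition.  Subtracting the staircase 1, 2, …, j, j, …, j, of weight
-- jm - C(j,2), leaves an arbitrary partition into at most m parts, counted by
-- 1/(q;q)_m.  For j = 0 the only condition is positivity, which is the
-- condition for j = 1; this yields the term q^m.

module Submission where

open import Defs
open import Data.Nat.Base using (ℕ; _≤_; _*_; _∸_)
open import Data.Nat.Combinatorics using (_C_)
open import Data.Product.Base using (∃; _×_)

open import Data.Empty using (⊥-elim)
open import Data.Fin.Base using (toℕ)
open import Data.Integer.Base as ℤ using (ℤ; 0ℤ; 1ℤ)
import Data.Integer.Properties as ℤ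
import Data.Integer.Tactic.RingSolver as ℤ-Solver
open import Data.List.Base using (List; []; _∷_; _++_; _∷ʳ_; applyDownFrom; foldr; length; map)
import Data.List.Properties as List
open import Data.List.Membership.Propositional using (_∈_)
import Data.List.Membership.Propositional.Properties as ∈
open import Data.List.Relation.Unary.All as All using (All; []; _∷_)
import Data.List.Relation.Unary.All.Properties as All
open import Data.List.Relation.Unary.AllPairs as AllPairs using (AllPairs; []; _∷_)
open import Data.List.Relation.Unary.Any using (Any; here; there)
import Data.List.Relation.Unary.Linked.Properties as Linked
open import Data.List.Relation.Unary.Unique.Propositional using (Unique)
import Data.List.Relation.Unary.Unique.Propositional.Properties as Unique
open import Data.Nat.Base using (zero; suc; _+_; _⊓_; _⊔_; _<_; z≤n; s≤s; s≤s⁻¹)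
open import Data.Nat.Combinatorics using (nC1≡n; nCk+nC[k+1]≡[n+1]C[k+1])
open import Data.Nat.Induction using (<-rec)
open import Data.Nat.ListAction using (sum)
open import Data.Nat.ListAction.Properties using (sum-++)
import Data.Nat.Properties as ℕ
open import Data.Nat.Tactic.RingSolver using (solve-∀)
open import Data.Product.Base using (_,_; proj₁; proj₂)
open import Data.Sum.Base using (_⊎_; inj₁; inj₂)
open import Function.Base using (_∘_; case_of_; flip)
open import Relation.Binary.PropositionalEquality
open import Relation.Nullary.Decidable using (yes; no)
open import Relation.Nullary.Negation using (¬_)

-- Formal power series

delay : Series → Series
delay f zero    = 0ℤ
delay f (suc n) = f n

shift : ℕ → Series → Series
shift zero    f = f
shift (suc k) f = delay (shift k f)

delay-cong : ∀ {f g} → f ≈ g → delay f ≈ delay g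
delay-cong f≈g zero    = refl
delay-cong f≈g (suc n) = f≈g n

shift-cong : ∀ k {f g} → f ≈ g → shift k f ≈ shift k g
shift-cong zero    f≈g = f≈g
shift-cong (suc k) f≈g = delay-cong (shift-cong k f≈g)

shift-+ : ∀ k f n → shift k f (k + n) ≡ f n
shift-+ zero    f n = refl
shift-+ (suc k) f n = shift-+ k f n

shift-< : ∀ {k n} f → n < k → shift k f n ≡ 0ℤ
shift-< {suc k} {zero}  f _         = refl
shift-< {suc k} {suc n} f (s≤s n<k) = shift-< f n<k

⊛-congʳ : ∀ f {g h} → g ≈ h → f ⊛ g ≈ f ⊛ h
⊛-congʳ f g≈h n = ℤΣ.sum-cong-≗ {suc n} λ i → cong (f (toℕ i) ℤ.*_) (g≈h (n ∸ toℕ i))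

⊛-congˡ : ∀ {f g} h → f ≈ g → f ⊛ h ≈ g ⊛ h
⊛-congˡ h f≈g n = ℤΣ.sum-cong-≗ {suc n} λ i → cong (ℤ._* h (n ∸ toℕ i)) (f≈g (toℕ i))

-- By computation, `(f ⊛ g) (suc n)` is `f 0` times `g (suc n)` plus `((f ∘ suc) ⊛ g) n`. This and
-- the following inductions on convolutions therefore peel off the constant term of the left factor
-- and recurse on its tail.
⊛-zeroʳ : ∀ f {g} n → (∀ {m} → m ≤ n → g m ≡ 0ℤ) → (f ⊛ g) n ≡ 0ℤ
⊛-zeroʳ f zero    g≡0 rewrite g≡0 {0} z≤n | ℤ.*-zeroʳ (f 0) = refl
⊛-zeroʳ f (suc n) g≡0
  rewrite g≡0 {suc n} ℕ.≤-refl | ℤ.*-zeroʳ (f 0)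
        | ⊛-zeroʳ (f ∘ suc) n (λ m≤n → g≡0 (ℕ.m≤n⇒m≤1+n m≤n)) = refl

⊛-distribˡ-⊕ : ∀ f g h → f ⊛ (g ⊕ h) ≈ f ⊛ g ⊕ f ⊛ h
⊛-distribˡ-⊕ f g h zero = lemma (f 0) (g 0) (h 0)
  where
  lemma : ∀ x y z → x ℤ.* (y ℤ.+ z) ℤ.+ 0ℤ ≡ x ℤ.* y ℤ.+ 0ℤ ℤ.+ (x ℤ.* z ℤ.+ 0ℤ)
  lemma = ℤ-Solver.solve-∀
⊛-distribˡ-⊕ f g h (suc n) rewrite ⊛-distribˡ-⊕ (f ∘ suc) g h n =
  lemma (f 0) (g (suc n)) (h (suc n)) (((f ∘ suc) ⊛ g) n) (((f ∘ suc) ⊛ h) n)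
  where
  lemma : ∀ x y z s t → x ℤ.* (y ℤ.+ z) ℤ.+ (s ℤ.+ t) ≡
                        x ℤ.* y ℤ.+ s ℤ.+ (x ℤ.* z ℤ.+ t)
  lemma = ℤ-Solver.solve-∀

⊛-distribˡ-⊖ : ∀ f g h → f ⊛ (g ⊖ h) ≈ f ⊛ g ⊖ f ⊛ h
⊛-distribˡ-⊖ f g h zero = lemma (f 0) (g 0) (h 0)
  where
  lemma : ∀ x y z → x ℤ.* (y ℤ.- z) ℤ.+ 0ℤ ≡ x ℤ.* y ℤ.+ 0ℤ ℤ.- (x ℤ.* z ℤ.+ 0ℤ)
  lemma = ℤ-Solver.solve-∀
⊛-distribˡ-⊖ f g h (suc n) rewrite ⊛-distribˡ-⊖ (f ∘ suc) g h n =
  lemma (f 0) (g (suc n)) (h (suc n)) (((f ∘ suc) ⊛ g) n) (((f ∘ suc) ⊛ h) n)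
  where
  lemma : ∀ x y z s t → x ℤ.* (y ℤ.- z) ℤ.+ (s ℤ.- t) ≡
                        x ℤ.* y ℤ.+ s ℤ.- (x ℤ.* z ℤ.+ t)
  lemma = ℤ-Solver.solve-∀

⊛-distribʳ-⊖ : ∀ f g h → (g ⊖ h) ⊛ f ≈ g ⊛ f ⊖ h ⊛ f
⊛-distribʳ-⊖ f g h zero = lemma (f 0) (g 0) (h 0)
  where
  lemma : ∀ x y z → (y ℤ.- z) ℤ.* x ℤ.+ 0ℤ ≡ y ℤ.* x ℤ.+ 0ℤ ℤ.- (z ℤ.* x ℤ.+ 0ℤ)
  lemma = ℤ-Solver.solve-∀
⊛-distribʳ-⊖ f g h (suc n) rewrite ⊛-distribʳ-⊖ f (g ∘ suc) (h ∘ suc) n =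
  lemma (f (suc n)) (g 0) (h 0) (((g ∘ suc) ⊛ f) n) (((h ∘ suc) ⊛ f) n)
  where
  lemma : ∀ x y z s t → (y ℤ.- z) ℤ.* x ℤ.+ (s ℤ.- t) ≡
                        y ℤ.* x ℤ.+ s ℤ.- (z ℤ.* x ℤ.+ t)
  lemma = ℤ-Solver.solve-∀

⊛-distribˡ-∑₁ : ∀ f N g → f ⊛ ∑₁ N g ≈ ∑₁ N (λ k → f ⊛ g k)
⊛-distribˡ-∑₁ f zero    g n = ⊛-zeroʳ f n λ _ → refl
⊛-distribˡ-∑₁ f (suc N) g n = trans
  (⊛-distribˡ-⊕ f (∑₁ N g) (g (suc N)) n)
  (cong (ℤ._+ (f ⊛ g (suc N)) n) (⊛-distribˡ-∑₁ f N g n))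

⊛-identityʳ : ∀ f → f ⊛ 1# ≈ f
⊛-identityʳ f zero    = trans (ℤ.+-identityʳ _) (ℤ.*-identityʳ (f 0))
⊛-identityʳ f (suc n) = trans
  (cong₂ ℤ._+_ (ℤ.*-zeroʳ (f 0)) (⊛-identityʳ (f ∘ suc) n))
  (ℤ.+-identityˡ (f (suc n)))

delay-⊛ : ∀ f g → delay f ⊛ g ≈ delay (f ⊛ g)
delay-⊛ f g zero    = refl
delay-⊛ f g (suc n) = ℤ.+-identityˡ ((f ⊛ g) n)

⊛-delay : ∀ f g → f ⊛ delay g ≈ delay (f ⊛ g)
⊛-delay f g zero          = cong (ℤ._+ 0ℤ) (ℤ.*-zeroʳ (f 0))
⊛-delay f g (suc zero)    = cong (ℤ._+_ (f 0 ℤ.* g 0)) (⊛-delay (f ∘ suc) g 0)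
⊛-delay f g (suc (suc n)) =
  cong (ℤ._+_ (f 0 ℤ.* g (suc n))) (⊛-delay (f ∘ suc) g (suc n))

shift-⊛ : ∀ k f g → shift k f ⊛ g ≈ shift k (f ⊛ g)
shift-⊛ zero    f g n = refl
shift-⊛ (suc k) f g n =
  trans (delay-⊛ (shift k f) g n) (delay-cong (shift-⊛ k f g) n)

⊛-shift : ∀ k f g → f ⊛ shift k g ≈ shift k (f ⊛ g)
⊛-shift zero    f g n = refl
⊛-shift (suc k) f g n =
  trans (⊛-delay f (shift k g) n) (delay-cong (⊛-shift k f g) n)

q^-shift : ∀ k → q^ k ≈ shift k 1#
q^-shift zero    n       = refl
q^-shift (suc k) zero    = refl
q^-shift (suc k) (suc n) = q^-shift k n

⊛-q^ : ∀ f k → f ⊛ q^ k ≈ shift k f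
⊛-q^ f k n = trans (⊛-congʳ f (q^-shift k) n)
  (trans (⊛-shift k f 1# n) (shift-cong k (⊛-identityʳ f) n))

-- Strong induction: once the lower coefficients of `g` vanish, the only surviving term of the
-- convolution at `n` is `f 0` times `g n`, and `f 0` is 1.
⊛-kernel : ∀ f g → f 0 ≡ 1ℤ → f ⊛ g ≈ 0# → g ≈ 0#
⊛-kernel f g f₀≡1 fg≈0 = <-rec _ λ n rec → trans (sym (leading n rec)) (fg≈0 n)
  where
  unit : ∀ x → f 0 ℤ.* x ≡ x
  unit x = trans (cong (ℤ._* x) f₀≡1) (ℤ.*-identityˡ x)
  leading : ∀ n → (∀ {m} → m < n → g m ≡ 0ℤ) → (f ⊛ g) n ≡ g n
  leading zero    rec = trans (ℤ.+-identityʳ _) (unit (g 0))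
  leading (suc n) rec = trans
    (cong₂ ℤ._+_ (unit (g (suc n))) (⊛-zeroʳ (f ∘ suc) n (rec ∘ s≤s)))
    (ℤ.+-identityʳ (g (suc n)))

⊛-cancelˡ : ∀ f g h → f 0 ≡ 1ℤ → f ⊛ g ≈ f ⊛ h → g ≈ h
⊛-cancelˡ f g h f₀≡1 fg≈fh n = ℤ.i-j≡0⇒i≡j (g n) (h n) (⊛-kernel f (g ⊖ h) f₀≡1
  (λ k → trans (⊛-distribˡ-⊖ f g h k) (ℤ.i≡j⇒i-j≡0 (fg≈fh k))) n)

-- Multiply by (q;q)_m and cancel: the factor 1 - q^(m+1) passes from the reciprocal to (q;q)_m,
-- completing it to (q;q)_(m+1), so both sides become 1. Combinatorially this is the recurrence for
-- partitions into at most m+1 parts.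
recip-qPoch : ∀ m → recip (qPoch (suc m)) ≈
                    recip (qPoch m) ⊕ shift (suc m) (recip (qPoch (suc m)))
recip-qPoch m n = lemma (⊛-cancelˡ p (r ⊖ shift k r) (recip p) (qPoch-constant m) products n)
  where
  open ≡-Reasoning
  k = suc m
  p = qPoch m
  r = recip (qPoch k)

  lemma : ∀ {x y z} → x ℤ.- y ≡ z → x ≡ z ℤ.+ y
  lemma {x} {y} refl = identity x y
    where
    identity : ∀ x y → x ≡ x ℤ.- y ℤ.+ y
    identity = ℤ-Solver.solve-∀

  factor : p ⊖ shift k p ≈ qPoch k
  factor n = sym (begin
    (p ⊛ (1# ⊖ q^ k)) n             ≡⟨ ⊛-distribˡ-⊖ p 1# (q^ k) n ⟩
    (p ⊛ 1#) n ℤ.- (p ⊛ q^ k) n     ≡⟨ cong₂ ℤ._-_ (⊛-identityʳ p n) (⊛-q^ p k n) ⟩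
    p n ℤ.- shift k p n             ∎)

  products : p ⊛ (r ⊖ shift k r) ≈ p ⊛ recip p
  products n = begin
    (p ⊛ (r ⊖ shift k r)) n            ≡⟨ ⊛-distribˡ-⊖ p r (shift k r) n ⟩
    (p ⊛ r) n ℤ.- (p ⊛ shift k r) n    ≡⟨ cong (ℤ._-_ ((p ⊛ r) n)) (⊛-shift k p r n) ⟩
    (p ⊛ r) n ℤ.- shift k (p ⊛ r) n    ≡⟨ cong (ℤ._-_ ((p ⊛ r) n)) (shift-⊛ k p r n) ⟨
    (p ⊛ r) n ℤ.- (shift k p ⊛ r) n    ≡⟨ ⊛-distribʳ-⊖ r p (shift k p) n ⟨
    ((p ⊖ shift k p) ⊛ r) n            ≡⟨ ⊛-congˡ r factor n ⟩
    (qPoch k ⊛ r) n                    ≡⟨ qPoch-inverseʳ k n ⟩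
    1# n                               ≡⟨ qPoch-inverseʳ m n ⟨
    (p ⊛ recip p) n                    ∎

-- Enumerations

-- The list holds bare elements without their proofs of `P`, so distinct proofs for one element are
-- not counted twice. The count is an integer because it is matched with a coefficient of a
-- `Series`.
record Enumerated {A : Set} (P : A → Set) (c : ℤ) : Set where
  field
    elements : List A
    unique   : Unique elements
    sound    : All P elements
    complete : ∀ {x} → P x → x ∈ elements
    count    : ℤ.+ length elements ≡ c

open Enumerated

module _ {A : Set} {P Q : A → Set} where

  enumerated-⇔ : (∀ {x} → P x → Q x) → (∀ {x} → Q x → P x) →
                 ∀ {c d} → c ≡ d → Enumerated P c → Enumerated Q d
  enumerated-⇔ P⇒Q Q⇒P refl e = record
    { elements = elements e
    ; unique   = unique e
    ; sound    = All.map P⇒Q (sound e)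
    ; complete = complete e ∘ Q⇒P
    ; count    = count e
    }

  enumerated-⊎ : (∀ {x} → P x → ¬ Q x) → ∀ {c d} →
                 Enumerated P c → Enumerated Q d →
                 Enumerated (λ x → P x ⊎ Q x) (c ℤ.+ d)
  enumerated-⊎ disjoint e f = record
    { elements = elements e ++ elements f
    ; unique   = Unique.++⁺ (unique e) (unique f) λ (x∈e , x∈f) →
                   disjoint (All.lookup (sound e) x∈e) (All.lookup (sound f) x∈f)
    ; sound    = All.tabulate λ x∈ → case ∈.∈-++⁻ (elements e) x∈ of λ where
                   (inj₁ x∈e) → inj₁ (All.lookup (sound e) x∈e)
                   (inj₂ x∈f) → inj₂ (All.lookup (sound f) x∈f)
    ; complete = λ where
                   (inj₁ p) → ∈.∈-++⁺ˡ (complete e p)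
                   (inj₂ q) → ∈.∈-++⁺ʳ (elements e) (complete f q)
    ; count    = trans (cong ℤ.+_ (List.length-++ (elements e)))
                   (cong₂ ℤ._+_ (count e) (count f))
    }

enumerated-∅ : ∀ {A : Set} {P : A → Set} → (∀ {x} → ¬ P x) → Enumerated P 0ℤ
enumerated-∅ empty = record
  { elements = []
  ; unique   = []
  ; sound    = []
  ; complete = λ p → ⊥-elim (empty p)
  ; count    = refl
  }

enumerated-singleton : ∀ {A : Set} (x : A) → Enumerated (_≡ x) 1ℤ
enumerated-singleton x = record
  { elements = x ∷ []
  ; unique   = [] ∷ []
  ; sound    = refl ∷ []
  ; complete = here
  ; count    = refl
  }

module _ {A B : Set} {P : A → Set} {Q : B → Set} where

  enumerated-image : (f : A → B) → (∀ {x y} → f x ≡ f y → x ≡ y) →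
                     (∀ {x} → P x → Q (f x)) →
                     (∀ {y} → Q y → ∃ λ x → P x × f x ≡ y) →
                     ∀ {c} → Enumerated P c → Enumerated Q c
  enumerated-image f injective P⇒Q surjective e = record
    { elements = map f (elements e)
    ; unique   = Unique.map⁺ injective (unique e)
    ; sound    = All.tabulate λ y∈ → case ∈.∈-map⁻ f y∈ of λ where
                   (x , x∈ , refl) → P⇒Q (All.lookup (sound e) x∈)
    ; complete = λ q → case surjective q of λ where
                   (x , p , refl) → ∈.∈-map⁺ f (complete e p)
    ; count    = trans (cong ℤ.+_ (List.length-map f (elements e))) (count e)
    }

  -- The bijection runs from the objects to be counted to those already listed and is injective on
  -- `Q` only, so the new list is built by choosing a preimage of every listed element. It serves
  -- for `sizes`, which forgets the overlines.
  enumerated-preimage : (g : B → A) →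
                        (∀ {x y} → Q x → Q y → g x ≡ g y → x ≡ y) →
                        (∀ {y} → Q y → P (g y)) →
                        (∀ {x} → P x → ∃ λ y → Q y × g y ≡ x) →
                        ∀ {c} → Enumerated P c → Enumerated Q c
  enumerated-preimage g injective Q⇒P surjective e = record
    { elements = proj₁ (lift (sound e))
    ; unique   = Unique.map⁻ (subst Unique (sym eq) (unique e))
    ; sound    = qs
    ; complete = λ q →
        case ∈.∈-map⁻ g (subst (_ ∈_) (sym eq) (complete e (Q⇒P q))) of λ
          (y , y∈ , eq′) → subst (_∈ ys) (sym (injective q (All.lookup qs y∈) eq′)) y∈
    ; count    = trans
        (cong ℤ.+_ (trans (sym (List.length-map g ys)) (cong length eq))) (count e)
    }
    where
    lift : ∀ {xs} → All P xs → ∃ λ ys → All Q ys × map g ys ≡ xs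
    lift []       = [] , [] , refl
    lift (p ∷ ps) with surjective p | lift ps
    ... | y , q , refl | ys , qs , refl = y ∷ ys , q ∷ qs , refl
    ys = proj₁ (lift (sound e))
    qs = proj₁ (proj₂ (lift (sound e)))
    eq = proj₂ (proj₂ (lift (sound e)))

-- Multiplication by q^k: for `n < k` the coefficient is 0 and the lower bound on the weight
-- excludes all objects; otherwise `n` is `k + j` and the coefficient is `F j`.
enumerated-shift : ∀ {A : Set} {w : A → ℕ} {P : A → Set} {F} k n →
                   (∀ j → k + j ≡ n → Enumerated (λ x → P x × w x ≡ n) (F j)) →
                   (∀ {x} → P x → k ≤ w x) →
                   Enumerated (λ x → P x × w x ≡ n) (shift k F n)
enumerated-shift {F = F} k n e k≤w with k ℕ.≤? n
... | no k≰n = subst (Enumerated _) (sym (shift-< F (ℕ.≰⇒> k≰n)))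
      (enumerated-∅ λ (p , eq) → k≰n (subst (k ≤_) eq (k≤w p)))
... | yes k≤n with j , refl ← ℕ.m≤n⇒∃[o]m+o≡n k≤n =
      subst (Enumerated _) (sym (shift-+ k F j)) (e j refl)

enumerated-∑₁ : ∀ {A : Set} (key : A → ℕ) {P : A → Set} {F n} N →
                (∀ {m} → 1 ≤ m → m ≤ N → Enumerated (λ x → key x ≡ m × P x) (F m n)) →
                Enumerated (λ x → (1 ≤ key x × key x ≤ N) × P x) (∑₁ N F n)
enumerated-∑₁ key zero    e = enumerated-∅ λ ((1≤k , k≤0) , _) → ℕ.<⇒≱ 1≤k k≤0
enumerated-∑₁ key (suc N) e = enumerated-⇔
  (λ where
    (inj₁ ((1≤k , k≤N) , p)) → (1≤k , ℕ.m≤n⇒m≤1+n k≤N) , p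
    (inj₂ (k≡ , p))          →
      (subst (1 ≤_) (sym k≡) (s≤s z≤n) , ℕ.≤-reflexive k≡) , p)
  (λ ((1≤k , k≤) , p) → case ℕ.m≤n⇒m<n∨m≡n k≤ of λ where
    (inj₁ (s≤s k≤N)) → inj₁ ((1≤k , k≤N) , p)
    (inj₂ k≡)        → inj₂ (k≡ , p))
  refl
  (enumerated-⊎
    (λ ((_ , k≤N) , _) (k≡ , _) → ℕ.<⇒≱ ℕ.≤-refl (subst (_≤ N) k≡ k≤N))
    (enumerated-∑₁ key N λ 1≤m m≤N → e 1≤m (ℕ.m≤n⇒m≤1+n m≤N))
    (e (s≤s z≤n) ℕ.≤-refl))

enumerated-none : ∀ {A : Set} {P : A → Set} {c} → (∀ {x} → ¬ P x) → Enumerated P c → c ≡ 0ℤ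
enumerated-none none e with elements e | sound e | count e
... | []    | _     | c = sym c
... | _ ∷ _ | p ∷ _ | _ = ⊥-elim (none p)

-- Lists of sizes

-- The default 0 acts as an imagined entry behind the last one, so that the end of a list obeys the
-- same inequalities as its other positions.
head₀ : List ℕ → ℕ
head₀ []      = 0
head₀ (y ∷ _) = y

-- Non-increasing, with strict descents between the last k entries and from the
-- last entry to an imagined 0 (if k > 0).
data Stair (k : ℕ) : List ℕ → Set where
  []   : Stair k []
  step : ∀ {y ys} → head₀ ys ≤ y → (length ys < k → head₀ ys < y) →
         Stair k ys → Stair k (y ∷ ys)

stair-≤ : ∀ {j k ys} → j ≤ k → Stair k ys → Stair j ys
stair-≤ j≤k []             = []
stair-≤ j≤k (step ≤y <y s) = step ≤y (λ l<j → <y (ℕ.<-≤-trans l<j j≤k)) (stair-≤ j≤k s)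

stair-positive : ∀ {k ys} → Stair (suc k) ys → All (1 ≤_) ys
stair-positive []                             = []
stair-positive {ys = _ ∷ []}     (step _ <y s) = <y (s≤s z≤n) ∷ []
stair-positive {ys = _ ∷ _ ∷ _} (step ≤y _ s) with stair-positive s
... | 1≤z ∷ 1≤zs = ℕ.≤-trans 1≤z ≤y ∷ 1≤z ∷ 1≤zs

positive-stair : ∀ {ys} → Stair 0 ys → All (1 ≤_) ys → Stair 1 ys
positive-stair []                             []         = []
positive-stair {_ ∷ []}    (step ≤y _ s) (1≤y ∷ ps) = step ≤y (λ _ → 1≤y) (positive-stair s ps)
positive-stair {_ ∷ _ ∷ _} (step ≤y _ s) (_   ∷ ps) = step ≤y (λ { (s≤s ()) }) (positive-stair s ps)

stair-∷ʳ0 : ∀ {ys} → Stair 0 ys → Stair 0 (ys ∷ʳ 0)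
stair-∷ʳ0 []                             = step z≤n (λ ()) []
stair-∷ʳ0 {_ ∷ []}     (step ≤y _ s) = step z≤n (λ ()) (stair-∷ʳ0 s)
stair-∷ʳ0 {_ ∷ _ ∷ _} (step ≤y _ s) = step ≤y (λ ()) (stair-∷ʳ0 s)

stair-map-suc : ∀ {ys} → Stair 0 ys → Stair 0 (map suc ys)
stair-map-suc []                             = []
stair-map-suc {_ ∷ []}     (step ≤y _ s) = step z≤n (λ ()) (stair-map-suc s)
stair-map-suc {_ ∷ _ ∷ _} (step ≤y _ s) = step (s≤s ≤y) (λ ()) (stair-map-suc s)

-- The last entry is the smallest, so it decides between the two cases. They correspond to the two
-- summands in `recip-qPoch`.
stair-zero-or-positive : ∀ {ys} → Stair 0 ys →
  (∃ λ zs → Stair 0 zs × zs ∷ʳ 0 ≡ ys) ⊎ All (1 ≤_) ys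
stair-zero-or-positive []                            = inj₂ []
stair-zero-or-positive {zero  ∷ []} (step _ _ s)     = inj₁ ([] , [] , refl)
stair-zero-or-positive {suc _ ∷ []} (step _ _ s)     = inj₂ (s≤s z≤n ∷ [])
stair-zero-or-positive {y ∷ _ ∷ _} (step ≤y _ s) with stair-zero-or-positive s
... | inj₁ ([]     , t , refl) = inj₁ (y ∷ [] , step z≤n (λ ()) t , refl)
... | inj₁ (z ∷ zs , t , refl) = inj₁ (y ∷ z ∷ zs , step ≤y (λ ()) t , refl)
... | inj₂ (1≤z ∷ ps)          = inj₂ (ℕ.≤-trans 1≤z ≤y ∷ 1≤z ∷ ps)

stair-pred : ∀ {ys} → All (1 ≤_) ys → Stair 0 ys →
             ∃ λ xs → Stair 0 xs × map suc xs ≡ ys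
stair-pred [] [] = [] , [] , refl
stair-pred {suc y ∷ _} (_ ∷ ps) (step ≤y _ s) with stair-pred ps s
... | []    , t , refl = y ∷ [] , step z≤n (λ ()) t , refl
... | _ ∷ _ , t , refl = y ∷ _ , step (s≤s⁻¹ ≤y) (λ ()) t , refl

-- Counting partitions into at most `m` parts

sum-∷ʳ0 : ∀ ys → sum (ys ∷ʳ 0) ≡ sum ys
sum-∷ʳ0 ys = trans (sum-++ ys (0 ∷ [])) (ℕ.+-identityʳ (sum ys))

length-∷ʳ : ∀ (ys : List ℕ) {y} → length (ys ∷ʳ y) ≡ suc (length ys)
length-∷ʳ ys = trans (List.length-++ ys) (ℕ.+-comm (length ys) 1)

sum-map-suc : ∀ ys → sum (map suc ys) ≡ length ys + sum ys
sum-map-suc []       = refl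
sum-map-suc (y ∷ ys) rewrite sum-map-suc ys = lemma y (length ys) (sum ys)
  where
  lemma : ∀ y l s → suc (y + (l + s)) ≡ suc (l + (y + s))
  lemma = solve-∀

length≤sum : ∀ {ys} → All (1 ≤_) ys → length ys ≤ sum ys
length≤sum []         = z≤n
length≤sum (1≤y ∷ ps) = ℕ.+-mono-≤ 1≤y (length≤sum ps)

-- Partitions into at most `m` parts, padded with zeros to length `m`; `Stair 0` asks for no strict
-- descent.
Descending : ℕ → List ℕ → Set
Descending m ys = Stair 0 ys × length ys ≡ m

recip-qPoch-0 : recip (qPoch 0) ≈ 1#
recip-qPoch-0 = ⊛-cancelˡ 1# (recip 1#) 1# refl λ n →
  trans (qPoch-inverseʳ 0 n) (sym (⊛-identityʳ 1# n))

-- Follows `recip-qPoch`: a list ending in 0 comes from a list one shorter of the same weight, an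
-- all-positive list from one with every entry lowered by 1, which costs `suc m` in weight. Hence an
-- induction on the length with a strong induction on the weight inside.
descending-enumerated : ∀ m n →
  Enumerated (λ ys → Descending m ys × sum ys ≡ n) (recip (qPoch m) n)
descending-enumerated zero zero = enumerated-⇔
  (λ { refl → ([] , refl) , refl }) (λ { {[]} _ → refl ; {_ ∷ _} ((_ , ()) , _) })
  (sym (recip-qPoch-0 0)) (enumerated-singleton [])
descending-enumerated zero (suc n) =
  subst (Enumerated _) (sym (recip-qPoch-0 (suc n)))
    (enumerated-∅ λ { {[]} (_ , ()) ; {_ ∷ _} ((_ , ()) , _) })
descending-enumerated (suc m) = <-rec _ λ n rec → enumerated-⇔
  (λ where
    (inj₁ (((zs , s , refl) , l) , eq)) → (stair-∷ʳ0 s , l) , eq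
    (inj₂ ((ps , s , l) , eq))          → (s , l) , eq)
  (λ ((s , l) , eq) → case stair-zero-or-positive s of λ where
    (inj₁ z)  → inj₁ ((z , l) , eq)
    (inj₂ ps) → inj₂ ((ps , s , l) , eq))
  (sym (recip-qPoch m n))
  (enumerated-⊎
    (λ where
      (((zs , _ , refl) , _) , _) ((ps , _) , _) → case All.++⁻ʳ zs ps of λ { (() ∷ _) })
    (enumerated-image (_∷ʳ 0) (List.∷ʳ-injectiveˡ _ _)
      (λ {ys} ((s , l) , eq) →
        ((ys , s , refl) , trans (length-∷ʳ ys) (cong suc l)) , trans (sum-∷ʳ0 ys) eq)
      (λ where
        (((zs , s , refl) , l) , eq) → zs
          , ((s , ℕ.suc-injective (trans (sym (length-∷ʳ zs)) l))
            , trans (sym (sum-∷ʳ0 zs)) eq)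
          , refl)
      (descending-enumerated m n))
    (enumerated-shift (suc m) n
      (λ { j refl → enumerated-image (map suc) (List.map-injective ℕ.suc-injective)
        (λ {ys} ((s , l) , eq) →
          (All.map⁺ (All.universal (λ _ → s≤s z≤n) ys) , stair-map-suc s
            , trans (List.length-map suc ys) l)
          , trans (sum-map-suc ys) (cong₂ _+_ l eq))
        (λ ((ps , s , l) , eq) → case stair-pred ps s of λ where
          (xs , t , refl) →
            let l′ = trans (sym (List.length-map suc xs)) l in
            xs , ((t , l′) , ℕ.+-cancelˡ-≡ (suc m) _ _
              (trans (sym (trans (sum-map-suc xs) (cong (_+ sum xs) l′))) eq)) , refl)
        (rec (s≤s (ℕ.m≤n+m j m))) })
      (λ { {ys} (ps , _ , l) → subst (_≤ sum ys) l (length≤sum ps) })))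

-- Adding a staircase to a partition

staircase : ℕ → ℕ → ℕ
staircase zero    k = 0
staircase (suc l) k = (suc l ⊓ k) + staircase l k

staircase-C : ∀ {m k} → m ≤ k → staircase m k ≡ suc m C 2
staircase-C {zero}  _ = refl
staircase-C {suc m} {k} m<k = begin
  (suc m ⊓ k) + staircase m k  ≡⟨ cong₂ _+_ (ℕ.m≤n⇒m⊓n≡m m<k) (staircase-C (ℕ.<⇒≤ m<k)) ⟩
  suc m + suc m C 2            ≡⟨ cong (_+ suc m C 2) (nC1≡n (suc m)) ⟨
  suc m C 1 + suc m C 2        ≡⟨ nCk+nC[k+1]≡[n+1]C[k+1] (suc m) 1 ⟩
  suc (suc m) C 2              ∎
  where open ≡-Reasoning

sucC2 : ∀ n → suc n C 2 ≡ n + n C 2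
sucC2 n = trans (sym (nCk+nC[k+1]≡[n+1]C[k+1] n 1)) (cong (_+ n C 2) (nC1≡n n))

consecutive-triangular : ∀ k → suc k C 2 + k C 2 ≡ k * k
consecutive-triangular zero    = refl
consecutive-triangular (suc k) = begin
  suc (suc k) C 2 + suc k C 2              ≡⟨ cong₂ _+_ (sucC2 (suc k)) (sucC2 k) ⟩
  suc k + suc k C 2 + (k + k C 2)          ≡⟨ regroup k (suc k C 2) (k C 2) ⟩
  suc (k + k) + (suc k C 2 + k C 2)        ≡⟨ cong (suc (k + k) +_) (consecutive-triangular k) ⟩
  suc (k + k) + k * k                      ≡⟨ square k ⟩
  suc k * suc k                            ∎
  where
  open ≡-Reasoning
  regroup : ∀ k x y → suc k + x + (k + y) ≡ suc (k + k) + (x + y)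
  regroup = solve-∀
  square : ∀ k → suc (k + k) + k * k ≡ suc k * suc k
  square = solve-∀

-- At `m = k` the staircase is a full triangle, and two consecutive triangular numbers make a
-- square; each further step adds `k` to both sides. The additive form keeps truncated subtraction
-- out of the induction.
staircase+C : ∀ {m k} → k ≤ m → staircase m k + k C 2 ≡ k * m
staircase+C {m} {k} k≤m with ℕ.m≤n⇒m<n∨m≡n k≤m
... | inj₂ refl = trans (cong (_+ k C 2) (staircase-C {k} ℕ.≤-refl)) (consecutive-triangular k)
staircase+C {suc m} {k} k≤m | inj₁ k<m = begin
  (suc m ⊓ k) + staircase m k + k C 2    ≡⟨ cong (λ i → i + staircase m k + k C 2) (ℕ.m≥n⇒m⊓n≡n k≤m) ⟩
  k + staircase m k + k C 2              ≡⟨ ℕ.+-assoc k (staircase m k) (k C 2) ⟩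
  k + (staircase m k + k C 2)            ≡⟨ cong (_+_ k) (staircase+C (s≤s⁻¹ k<m)) ⟩
  k + k * m                              ≡⟨ ℕ.*-suc k m ⟨
  k * suc m                              ∎
  where open ≡-Reasoning

staircase-closed : ∀ {m k} → k ≤ m → staircase m k ≡ k * m ∸ k C 2
staircase-closed {m} {k} k≤m =
  trans (sym (ℕ.m+n∸n≡m (staircase m k) (k C 2))) (cong (_∸ k C 2) (staircase+C k≤m))

-- The amount min(l, k) added to the l-th entry from the end is the least value that `Stair k`
-- permits there.
raise : ℕ → List ℕ → List ℕ
raise k []       = []
raise k (y ∷ ys) = y + (suc (length ys) ⊓ k) ∷ raise k ys

length-raise : ∀ k ys → length (raise k ys) ≡ length ys
length-raise k []       = refl
length-raise k (y ∷ ys) = cong suc (length-raise k ys)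

sum-raise : ∀ k ys → sum (raise k ys) ≡ staircase (length ys) k + sum ys
sum-raise k []       = refl
sum-raise k (y ∷ ys) rewrite sum-raise k ys =
  lemma y (suc (length ys) ⊓ k) (staircase (length ys) k) (sum ys)
  where
  lemma : ∀ y a b s → y + a + (b + s) ≡ a + b + (y + s)
  lemma = solve-∀

-- Tails first: equal tails have equal lengths, so both heads were raised by the same amount.
raise-injective : ∀ k {xs ys} → raise k xs ≡ raise k ys → xs ≡ ys
raise-injective k {[]}     {[]}     _  = refl
raise-injective k {x ∷ xs} {y ∷ ys} eq
  with eqₕ , eqₜ ← List.∷-injective eq
  with refl ← raise-injective k {xs} {ys} eqₜ =
  cong (_∷ xs) (ℕ.+-cancelʳ-≡ (suc (length xs) ⊓ k) x y eqₕ)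

head₀-raise : ∀ k ys → head₀ (raise k ys) ≡ head₀ ys + (length ys ⊓ k)
head₀-raise k []       = refl
head₀-raise k (y ∷ ys) = refl

-- From one position to the next the added amount min(l, k) grows weakly, and by exactly 1 while l <
-- k, which is where `Stair k` demands strictness.
raise-stair : ∀ k {ys} → Stair 0 ys → Stair k (raise k ys)
raise-stair k []                               = []
raise-stair k {y ∷ ys} (step ≤y _ s) = step
  (begin
    head₀ (raise k ys)         ≡⟨ head₀-raise k ys ⟩
    head₀ ys + (l ⊓ k)         ≤⟨ ℕ.+-mono-≤ ≤y (ℕ.⊓-monoˡ-≤ k (ℕ.n≤1+n l)) ⟩
    y + (suc l ⊓ k)            ∎)
  (λ l<k′ → let l<k = subst (_< k) (length-raise k ys) l<k′ in begin-strict
    head₀ (raise k ys)         ≡⟨ head₀-raise k ys ⟩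
    head₀ ys + (l ⊓ k)         ≡⟨ cong (head₀ ys +_) (ℕ.m≤n⇒m⊓n≡m (ℕ.<⇒≤ l<k)) ⟩
    head₀ ys + l               <⟨ ℕ.+-mono-≤-< ≤y ℕ.≤-refl ⟩
    y + suc l                  ≡⟨ cong (y +_) (ℕ.m≤n⇒m⊓n≡m l<k) ⟨
    y + (suc l ⊓ k)            ∎)
  (raise-stair k s)
  where
  open ℕ.≤-Reasoning
  l = length ys

raise-surjective : ∀ {k zs} → Stair k zs → ∃ λ ys → Stair 0 ys × raise k ys ≡ zs
raise-surjective [] = [] , [] , refl
raise-surjective {k} {z ∷ _} (step ≤z <z s) with raise-surjective s
... | ys , t , refl = z ∸ c ∷ ys
  , step (ℕ.m+n≤o⇒m≤o∸n (head₀ ys) enough) (λ ()) t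
  , cong (_∷ raise k ys) (ℕ.m∸n+n≡m (ℕ.m+n≤o⇒n≤o (head₀ ys) enough))
  where
  l = length ys
  c = suc l ⊓ k
  -- This keeps `z ∸ c` from truncating. For `l < k` the strict descent pays for the extra 1 in `c`;
  -- for `l ≥ k` both neighbours were raised by `k`.
  enough : head₀ ys + c ≤ z
  enough with l ℕ.<? k
  ... | yes l<k rewrite ℕ.m≤n⇒m⊓n≡m l<k | ℕ.+-suc (head₀ ys) l =
    subst (_< z) (trans (head₀-raise k ys) (cong (head₀ ys +_) (ℕ.m≤n⇒m⊓n≡m (ℕ.<⇒≤ l<k))))
      (<z (subst (_< k) (sym (length-raise k ys)) l<k))
  ... | no l≮k = subst (_≤ z) (trans (head₀-raise k ys) (cong (head₀ ys +_)
      (trans (ℕ.m≥n⇒m⊓n≡n k≤l) (sym (ℕ.m≥n⇒m⊓n≡n (ℕ.m≤n⇒m≤1+n k≤l)))))) ≤z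
    where k≤l = ℕ.≮⇒≥ l≮k

stair-enumerated : ∀ m k n →
  Enumerated (λ ys → (Stair k ys × length ys ≡ m) × sum ys ≡ n)
             (shift (staircase m k) (recip (qPoch m)) n)
stair-enumerated m k n = enumerated-shift (staircase m k) n
  (λ { j refl → enumerated-image (raise k) (raise-injective k)
    (λ { {ys} ((s , refl) , refl) →
      (raise-stair k s , length-raise k ys) , sum-raise k ys })
    (λ ((s , l) , eq) → case raise-surjective s of λ where
      (ys , t , refl) →
        let l′ = trans (sym (length-raise k ys)) l in
        ys , ((t , l′) , ℕ.+-cancelˡ-≡ (staircase m k) _ _
          (trans (sym (trans (sum-raise k ys)
            (cong (λ i → staircase i k + sum ys) l′))) eq)) , refl)
    (descending-enumerated m j) })
  (λ (s , l) → case raise-surjective s of λ where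
    (ys , t , refl) → subst₂ _≤_
      (cong (λ i → staircase i k) (trans (sym (length-raise k ys)) l))
      (sym (sum-raise k ys)) (ℕ.m≤m+n _ (sum ys)))

-- Overpartitions

infix 4 _⊵_

-- The pairwise form of the defining conditions of 𝓔_O^N: p ⊵ r iff p may
-- precede r.
_⊵_ : Part → Part → Set
p            ⊵ overlined b = b < size p
plain a      ⊵ plain b     = b ≤ a
overlined a  ⊵ plain b     = b ≡ a

Chain : List Part → Set
Chain = AllPairs _⊵_

overlines : List Part → ℕ
overlines []                = 0
overlines (plain _ ∷ π)     = overlines π
overlines (overlined _ ∷ π) = suc (overlines π)

overlines≤length : ∀ π → overlines π ≤ length π
overlines≤length []                = z≤n
overlines≤length (plain _ ∷ π)     = ℕ.m≤n⇒m≤1+n (overlines≤length π)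
overlines≤length (overlined _ ∷ π) = s≤s (overlines≤length π)

anyPlain⇒overlines<length : ∀ {π} → Any Plain π → overlines π < length π
anyPlain⇒overlines<length {plain _ ∷ π}     _         = s≤s (overlines≤length π)
anyPlain⇒overlines<length {overlined _ ∷ π} (there p) = s≤s (anyPlain⇒overlines<length p)

overlines<length⇒anyPlain : ∀ {π} → overlines π < length π → Any Plain π
overlines<length⇒anyPlain {plain _ ∷ π}     _       = here plain
overlines<length⇒anyPlain {overlined _ ∷ π} (s≤s p) = there (overlines<length⇒anyPlain p)

length≤overlines⇒allOverlined : ∀ {π} → length π ≤ overlines π → All Overlined π
length≤overlines⇒allOverlined {[]}              _       = []
length≤overlines⇒allOverlined {plain _ ∷ π}     l       = ⊥-elim (ℕ.<⇒≱ l (overlines≤length π))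
length≤overlines⇒allOverlined {overlined _ ∷ π} (s≤s l) = overlined ∷ length≤overlines⇒allOverlined l

⊵⇒≥ : ∀ p r → p ⊵ r → size r ≤ size p
⊵⇒≥ (plain _)     (overlined _) b<a = ℕ.<⇒≤ b<a
⊵⇒≥ (overlined _) (overlined _) b<a = ℕ.<⇒≤ b<a
⊵⇒≥ (plain _)     (plain _)     b≤a = b≤a
⊵⇒≥ (overlined _) (plain _)     b≡a = ℕ.≤-reflexive b≡a

⊵⇒≢ : ∀ p r → p ⊵ r → Overlined r → size p ≢ size r
⊵⇒≢ p (overlined b) b<a overlined a≡b = ℕ.<⇒≢ b<a (sym a≡b)

chain⇒plain≥overlined : ∀ {π p r} → Chain π → p ∈ π → r ∈ π →
                        Plain p → Overlined r → size r ≤ size p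
chain⇒plain≥overlined (c ∷ cs) (here refl) (there r∈)  plain overlined = ℕ.<⇒≤ (All.lookup c r∈)
chain⇒plain≥overlined (c ∷ cs) (there p∈)  (here refl) plain overlined = ℕ.≤-reflexive (sym (All.lookup c p∈))
chain⇒plain≥overlined (c ∷ cs) (there p∈)  (there r∈)  p     r         = chain⇒plain≥overlined cs p∈ r∈ p r

ordered⇒chain : ∀ {π} → AllPairs (λ p r → size r ≤ size p) π →
                AllPairs (λ p r → Overlined r → size p ≢ size r) π →
                (∀ {p r} → p ∈ π → r ∈ π → Plain p → Overlined r → size r ≤ size p) →
                Chain π
ordered⇒chain []         []         _   = []
ordered⇒chain {p ∷ π} (ge ∷ ges) (ne ∷ nes) p≥o =
  All.tabulate (λ {r} r∈ → follows p r r∈ (All.lookup ge r∈) (All.lookup ne r∈) p≥o)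
  ∷ ordered⇒chain ges nes (λ p∈ r∈ → p≥o (there p∈) (there r∈))
  where
  follows : ∀ p {π} r → r ∈ π → size r ≤ size p → (Overlined r → size p ≢ size r) →
            (∀ {p′ r′} → p′ ∈ p ∷ π → r′ ∈ p ∷ π → Plain p′ → Overlined r′ → size r′ ≤ size p′) →
            p ⊵ r
  follows (plain _)     (plain _)     r∈ r≤p p≢r p≥o = r≤p
  -- The order bounds the later plain part from above, and the condition that plain parts dominate
  -- overlined ones bounds it from below.
  follows (overlined _) (plain _)     r∈ r≤p p≢r p≥o =
    ℕ.≤-antisym r≤p (p≥o (there r∈) (here refl) plain overlined)
  follows (plain _)     (overlined _) r∈ r≤p p≢r p≥o = ℕ.≤∧≢⇒< r≤p (p≢r overlined ∘ sym)
  follows (overlined _) (overlined _) r∈ r≤p p≢r p≥o = ℕ.≤∧≢⇒< r≤p (p≢r overlined ∘ sym)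

Positive : List Part → Set
Positive = All (λ p → 1 ≤ size p)

EON⇒ : ∀ {π} → EON π → Chain π × Positive π × overlines π < length π
EON⇒ e = ordered⇒chain
    (Linked.Linked⇒AllPairs (flip ℕ.≤-trans) nonIncreasing) overlineFirst plain≥overlined
  , positive
  , anyPlain⇒overlines<length somePlain
  where
  open EON e
  open IsOverpartition isOverpartition

EON⇐ : ∀ {π} → Chain π → Positive π → overlines π < length π → EON π
EON⇐ chain positive o<l = record
  { isOverpartition = record
    { positive      = positive
    ; nonIncreasing = Linked.AllPairs⇒Linked (AllPairs.map (⊵⇒≥ _ _) chain)
    ; overlineFirst = AllPairs.map (⊵⇒≢ _ _) chain
    }
  ; somePlain       = overlines<length⇒anyPlain o<l
  ; plain≥overlined = chain⇒plain≥overlined chain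
  }

-- The sizes of a chain form a stair

sizes : List Part → List ℕ
sizes = map size

head₀-≤ : ∀ p {π} → All (p ⊵_) π → head₀ (sizes π) ≤ size p
head₀-≤ p []            = z≤n
head₀-≤ p {r ∷ _} (c ∷ _) = ⊵⇒≥ p r c

head₀-< : ∀ p {π} → 1 ≤ size p → All Overlined π → All (p ⊵_) π → head₀ (sizes π) < size p
head₀-< p 1≤p []              []      = 1≤p
head₀-< p _   (overlined ∷ _) (c ∷ _) = c

allOverlined-stair : ∀ {k π} → All Overlined π → Chain π → Positive π → Stair k (sizes π)
allOverlined-stair []             []       []         = []
allOverlined-stair {π = p ∷ _} (_ ∷ os) (c ∷ cs) (1≤p ∷ ps) = step
  (head₀-≤ p c) (λ _ → head₀-< p 1≤p os c) (allOverlined-stair os cs ps)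

-- A plain part behind both overlined parts would have to equal each of `a` and `b`. So from the
-- second overlined part on, all parts are overlined and all descents strict.
below-overlined-allOverlined : ∀ {a b π} → b < a → All (overlined a ⊵_) π →
                               All (overlined b ⊵_) π → All Overlined π
below-overlined-allOverlined b<a [] [] = []
below-overlined-allOverlined {π = plain _ ∷ _} b<a (refl ∷ _) (refl ∷ _) = ⊥-elim (ℕ.<-irrefl refl b<a)
below-overlined-allOverlined {π = overlined _ ∷ _} b<a (_ ∷ as) (_ ∷ bs) =
  overlined ∷ below-overlined-allOverlined b<a as bs

-- Below an overlined a, every plain part equals a and every overlined part is
-- smaller, so the smallest plain part still lies strictly above its successor.
overlined-chain-stair : ∀ {a π} → All (overlined a ⊵_) π → Chain π → Positive π →
                        Stair (suc (overlines π)) (sizes π)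
overlined-chain-stair [] [] [] = []
overlined-chain-stair {π = plain a ∷ π} (refl ∷ as) (c ∷ cs) (1≤a ∷ ps) = step
  (head₀-≤ (plain a) c)
  (λ l<1+o → head₀-< (overlined a) 1≤a
    (length≤overlines⇒allOverlined (subst (_≤ overlines π) (List.length-map size π) (s≤s⁻¹ l<1+o))) as)
  (overlined-chain-stair as cs ps)
overlined-chain-stair {π = overlined b ∷ π} (b<a ∷ as) (c ∷ cs) ps =
  allOverlined-stair (overlined ∷ below-overlined-allOverlined b<a as c) (c ∷ cs) ps

-- Strictness is demanded only where the parts from that position on are no more than all the
-- overlines. This cannot happen at a plain head; at an overlined head it forces every later part to
-- be overlined. The tail of an overlined head has one overline fewer but must meet the same bound,
-- hence `overlined-chain-stair`.
chain-stair : ∀ {π} → Chain π → Positive π → Stair (overlines π) (sizes π)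
chain-stair [] [] = []
chain-stair {plain a ∷ π} (c ∷ cs) (_ ∷ ps) = step
  (head₀-≤ (plain a) c)
  (λ l<o → ⊥-elim (ℕ.<⇒≱ (subst (_< overlines π) (List.length-map size π) l<o) (overlines≤length π)))
  (chain-stair cs ps)
chain-stair {overlined a ∷ π} (c ∷ cs) (1≤a ∷ ps) = step
  (head₀-≤ (overlined a) c)
  (λ l<1+o → head₀-< (overlined a) 1≤a
    (length≤overlines⇒allOverlined (subst (_≤ overlines π) (List.length-map size π) (s≤s⁻¹ l<1+o))) c)
  (overlined-chain-stair c cs ps)

-- Uniqueness of the overlining

below : ℕ → List ℕ → ℕ
below a []       = 0
below a (y ∷ ys) with y ℕ.<? a
... | yes _ = suc (below a ys)
... | no  _ = below a ys

overlines≤below : ∀ {a π} → All (plain a ⊵_) π → overlines π ≤ below a (sizes π)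
overlines≤below [] = z≤n
overlines≤below {a} {plain b ∷ _} (_ ∷ as) with b ℕ.<? a
... | yes _ = ℕ.m≤n⇒m≤1+n (overlines≤below as)
... | no  _ = overlines≤below as
overlines≤below {a} {overlined b ∷ _} (b<a ∷ as) with b ℕ.<? a
... | yes _   = s≤s (overlines≤below as)
... | no  b≮a = ⊥-elim (b≮a b<a)

below≤overlines : ∀ {a π} → All (overlined a ⊵_) π → below a (sizes π) ≤ overlines π
below≤overlines [] = z≤n
below≤overlines {a} {plain b ∷ _} (refl ∷ as) with b ℕ.<? a
... | yes a<a = ⊥-elim (ℕ.<-irrefl refl a<a)
... | no  _   = below≤overlines as
below≤overlines {a} {overlined b ∷ _} (_ ∷ as) with b ℕ.<? a
... | yes _ = s≤s (below≤overlines as)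
... | no  _ = ℕ.m≤n⇒m≤1+n (below≤overlines as)

-- Compare with the number of entries below `a`: behind `plain a` they include every overlined part,
-- behind `overlined a` each of them is overlined. So `π` has at most as many overlines as `ρ`, not
-- one more.
plain≢overlined : ∀ {a π ρ} → All (plain a ⊵_) π → All (overlined a ⊵_) ρ →
                  sizes π ≡ sizes ρ → overlines π ≢ suc (overlines ρ)
plain≢overlined {a} as bs s≡ o≡ = ℕ.<⇒≱
  (subst (_ <_) (sym o≡) (s≤s (below≤overlines bs)))
  (subst (λ ys → _ ≤ below a ys) s≡ (overlines≤below as))

chain-unique : ∀ {π ρ} → Chain π → Chain ρ → sizes π ≡ sizes ρ →
               overlines π ≡ overlines ρ → π ≡ ρ
chain-unique {[]}              {[]}              _ _ _ _ = refl
chain-unique {plain _ ∷ _}     {plain _ ∷ _}     (_ ∷ cs) (_ ∷ ds) s≡ o≡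
  with refl , s≡′ ← List.∷-injective s≡ = cong (_ ∷_) (chain-unique cs ds s≡′ o≡)
chain-unique {overlined _ ∷ _} {overlined _ ∷ _} (_ ∷ cs) (_ ∷ ds) s≡ o≡
  with refl , s≡′ ← List.∷-injective s≡ = cong (_ ∷_) (chain-unique cs ds s≡′ (ℕ.suc-injective o≡))
chain-unique {plain _ ∷ _}     {overlined _ ∷ _} (c ∷ _) (d ∷ _) s≡ o≡
  with refl , s≡′ ← List.∷-injective s≡ = ⊥-elim (plain≢overlined c d s≡′ o≡)
chain-unique {overlined _ ∷ _} {plain _ ∷ _}     (c ∷ _) (d ∷ _) s≡ o≡
  with refl , s≡′ ← List.∷-injective s≡ = ⊥-elim (plain≢overlined d c (sym s≡′) (sym o≡))

-- Existence of the overlining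

plain-⊵-trans : ∀ {a} p r → p ⊵ r → size p ≤ a → plain a ⊵ r
plain-⊵-trans p (overlined _) b<p p≤a = ℕ.<-≤-trans b<p p≤a
plain-⊵-trans p (plain _)     p⊵r p≤a = ℕ.≤-trans (⊵⇒≥ p (plain _) p⊵r) p≤a

-- A plain part as large as a leading overlined part has to enter behind it.
insert-plain : ∀ {y π} → Chain π → head₀ (sizes π) ≤ y →
               ∃ λ ρ → Chain ρ × sizes ρ ≡ y ∷ sizes π × overlines ρ ≡ overlines π
insert-plain {y} {[]} [] _ = plain y ∷ [] , [] ∷ [] , refl , refl
insert-plain {y} {plain b ∷ π} (c ∷ cs) b≤y =
  plain y ∷ plain b ∷ π
  , (b≤y ∷ All.map (λ {r} b⊵r → plain-⊵-trans (plain b) r b⊵r b≤y) c) ∷ c ∷ cs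
  , refl , refl
insert-plain {y} {overlined b ∷ π} (c ∷ cs) b≤y with ℕ.m≤n⇒m<n∨m≡n b≤y
... | inj₁ b<y =
  plain y ∷ overlined b ∷ π
  , (b<y ∷ All.map (λ {r} b⊵r → plain-⊵-trans (overlined b) r b⊵r b≤y) c) ∷ c ∷ cs
  , refl , refl
... | inj₂ refl =
  overlined y ∷ plain y ∷ π
  , (refl ∷ c) ∷ All.map (λ {r} y⊵r → plain-⊵-trans (overlined y) r y⊵r ℕ.≤-refl) c ∷ cs
  , refl , refl

stair-bounded : ∀ {k y ys} → head₀ ys ≤ y → Stair k ys → All (_≤ y) ys
stair-bounded _   []             = []
stair-bounded ≤y  (step ≤z _ s)  = ≤y ∷ stair-bounded (ℕ.≤-trans ≤z ≤y) s

stair-strictly-bounded : ∀ {k y ys} → head₀ ys < y → Stair k ys → All (_< y) ys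
stair-strictly-bounded {y = suc y} <y s = All.map s≤s (stair-bounded (s≤s⁻¹ <y) s)

overlined-chain : ∀ {k ys} → length ys ≤ k → Stair k ys → Chain (map overlined ys)
overlined-chain _   []            = []
overlined-chain l<k (step _ <y s) =
  All.map⁺ (stair-strictly-bounded (<y l<k) s) ∷ overlined-chain (ℕ.<⇒≤ l<k) s

sizes-overlined : ∀ ys → sizes (map overlined ys) ≡ ys
sizes-overlined []       = refl
sizes-overlined (y ∷ ys) = cong (y ∷_) (sizes-overlined ys)

overlines-overlined : ∀ ys → overlines (map overlined ys) ≡ length ys
overlines-overlined []       = refl
overlines-overlined (y ∷ ys) = cong suc (overlines-overlined ys)

-- Built from the smallest size upwards: the last `k` entries are overlined, which their strict
-- descents allow, and every further entry contributes a plain part through `insert-plain`.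
chain-exists : ∀ {k ys} → k ≤ length ys → Stair k ys →
               ∃ λ π → Chain π × sizes π ≡ ys × overlines π ≡ k
chain-exists z≤n [] = [] , [] , refl , refl
chain-exists {k} {y ∷ ys} k≤ s with ℕ.m≤n⇒m<n∨m≡n k≤
... | inj₂ refl = map overlined (y ∷ ys) , overlined-chain ℕ.≤-refl s
                , sizes-overlined (y ∷ ys) , overlines-overlined (y ∷ ys)
chain-exists _ (step ≤y _ s) | inj₁ (s≤s k≤l) with chain-exists k≤l s
... | π , c , refl , refl = insert-plain c ≤y

-- The generating function

EONof : ℕ → ℕ → List Part → Set
EONof m n π = length π ≡ m × EON π × weight π ≡ n

-- The maximum with 1 encodes positivity: without overlines, it is the strict descent from the last
-- size to the imagined 0.
EON-stair : ∀ {π} → EON π → Stair (1 ⊔ overlines π) (sizes π)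
EON-stair {π} e with EON⇒ e
... | chain , positive , _ with overlines π | chain-stair chain positive
... | zero  | s = positive-stair s (All.map⁺ positive)
... | suc _ | s = s

EON-exists : ∀ {j ys} → j < length ys → Stair (1 ⊔ j) ys →
             ∃ λ π → EON π × sizes π ≡ ys × overlines π ≡ j
EON-exists {j} {ys} j<l s with chain-exists (ℕ.<⇒≤ j<l) (stair-≤ (ℕ.m≤n⊔m 1 j) s)
... | π , c , refl , refl =
  π , EON⇐ c (All.map⁻ (stair-positive (stair-≤ (ℕ.m≤m⊔n 1 j) s)))
        (subst (j <_) (List.length-map size π) j<l)
    , refl , refl

-- For a fixed number `j` of overlines the overlining can be recovered from the sizes, so `sizes` is
-- a bijection onto stairs of length `m`; `j < m` leaves room for a plain part.
EON-enumerated : ∀ {j m} n → j < m →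
  Enumerated (λ π → overlines π ≡ j × EONof m n π)
             (shift (staircase m (1 ⊔ j)) (recip (qPoch m)) n)
EON-enumerated {j} {m} n j<m = enumerated-preimage sizes
  (λ (o , _ , e , _) (o′ , _ , e′ , _) s≡ →
    chain-unique (proj₁ (EON⇒ e)) (proj₁ (EON⇒ e′)) s≡ (trans o (sym o′)))
  (λ { {π} (refl , l , e , w) → (EON-stair e , trans (List.length-map size π) l) , w })
  (λ { {ys} ((s , refl) , w) → case EON-exists j<m s of λ where
    (π , e , s≡ , o) → π
      , (o , trans (sym (List.length-map size π)) (cong length s≡) , e , trans (cong sum s≡) w)
      , s≡ })
  (stair-enumerated m (1 ⊔ j) n)

term : ℕ → Series
term m = recip (qPoch m) ⊛ (q^ m ⊕ ∑₁ (m ∸ 1) (λ k → q^ (k * m ∸ (k C 2))))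

term-enumerated : ∀ {m} n → 1 ≤ m → Enumerated (EONof m n) (term m n)
term-enumerated {m@(suc m-1)} n 1≤m = enumerated-⇔
  (λ where
    (inj₁ (_ , e)) → e
    (inj₂ (_ , e)) → e)
  (λ {π} (l , e , w) → case overlines π ℕ.≟ 0 of λ where
    (yes o≡0) → inj₁ (o≡0 , l , e , w)
    (no  o≢0) → inj₂ ((ℕ.n≢0⇒n>0 o≢0
      , s≤s⁻¹ (subst (overlines π <_) l (proj₂ (proj₂ (EON⇒ e))))
      ) , l , e , w))
  (sym (trans (⊛-distribˡ-⊕ r (q^ m) (∑₁ m-1 g) n)
    (cong (ℤ._+_ ((r ⊛ q^ m) n)) (⊛-distribˡ-∑₁ r m-1 g n))))
  (enumerated-⊎
    (λ (o≡0 , _) ((1≤o , _) , _) → ℕ.<⇒≢ 1≤o (sym o≡0))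
    (subst (Enumerated _)
      -- No overlines: the staircase consists of `m` ones, and `1 C 2` evaluates to 0, which leaves
      -- `q^ m`.
      (monomial (trans (staircase-closed 1≤m) (ℕ.*-identityˡ m)))
      (EON-enumerated n 1≤m))
    -- Matching the number of overlines with `suc _` lets its maximum with 1 reduce to the number
    -- itself.
    (enumerated-∑₁ overlines {F = λ k → r ⊛ g k} m-1 λ { {suc _} _ k≤m-1 → subst (Enumerated _)
        (monomial (staircase-closed (ℕ.m≤n⇒m≤1+n k≤m-1)))
        (EON-enumerated n (s≤s k≤m-1)) }))
  where
  r = recip (qPoch m)
  g : ℕ → Series
  g k = q^ (k * m ∸ (k C 2))
  monomial : ∀ {i j} → i ≡ j → shift i r n ≡ (r ⊛ q^ j) n
  monomial {i} refl = sym (⊛-q^ r i n)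

EON-length≤weight : ∀ {π} → EON π → length π ≤ weight π
EON-length≤weight {π} e = subst (_≤ weight π) (List.length-map size π)
  (length≤sum (All.map⁺ (proj₁ (proj₂ (EON⇒ e)))))

EON-length-positive : ∀ {π} → EON π → 1 ≤ length π
EON-length-positive e = ℕ.≤-trans (s≤s z≤n) (proj₂ (proj₂ (EON⇒ e)))

EON-weight-enumerated : ∀ n →
  Enumerated (λ π → EON π × weight π ≡ n) (∑₁ n term n)
EON-weight-enumerated n = enumerated-⇔ proj₂
  (λ { (e , refl) → (EON-length-positive e , EON-length≤weight e) , e , refl })
  refl
  (enumerated-∑₁ length n λ 1≤m _ → term-enumerated n 1≤m)

-- Read off from the count: `m` positive parts weigh at least `m`, so there is nothing to count at a
-- smaller weight.
term-vanishes : ∀ {m n} → 1 ≤ m → n < m → term m n ≡ 0ℤ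
term-vanishes {n = n} 1≤m n<m = enumerated-none
  (λ { (refl , e , refl) → ℕ.<⇒≱ n<m (EON-length≤weight e) })
  (term-enumerated n 1≤m)

q^-diagonal : ∀ {k n} → k ≡ n → (q^ k) n ≡ 1ℤ
q^-diagonal {zero}  refl = refl
q^-diagonal {suc k} refl = q^-diagonal {k} refl

q^-off-diagonal : ∀ {k n} → k ≢ n → (q^ k) n ≡ 0ℤ
q^-off-diagonal {zero}  {zero}  k≢n = ⊥-elim (k≢n refl)
q^-off-diagonal {zero}  {suc _} k≢n = refl
q^-off-diagonal {suc _} {zero}  k≢n = refl
q^-off-diagonal {suc k} {suc n} k≢n = q^-off-diagonal {k} (k≢n ∘ cong suc)

-- At the coefficient of q^n each listed object contributes 1 and every other object of `P`
-- contributes 0.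
enumerated⇒sumsTo : ∀ {A : Set} {P : A → Set} {w : A → ℕ} {S} →
                    (∀ n → Enumerated (λ x → P x × w x ≡ n) (S n)) →
                    SumsTo P (λ x → q^ (w x)) S
enumerated⇒sumsTo {P = P} {w} e n =
    elements (e n)
  , unique (e n)
  , All.map proj₁ (sound (e n))
  , (λ x p x∉ → q^-off-diagonal λ w≡n → x∉ (complete (e n) (p , w≡n)))
  , trans (sym (count (e n))) (sym (ones (sound (e n))))
  where
  ones : ∀ {xs} → All (λ x → P x × w x ≡ n) xs →
         foldr ℤ._+_ 0ℤ (map (λ x → (q^ (w x)) n) xs) ≡ ℤ.+ length xs
  ones []              = refl
  ones ((_ , w≡n) ∷ ps) = cong₂ ℤ._+_ (q^-diagonal w≡n) (ones ps)

∑₁-foldr : ∀ N (f : ℕ → Series) n →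
           ∑₁ N f n ≡ foldr ℤ._+_ 0ℤ (map (λ m → f m n) (applyDownFrom suc N))
∑₁-foldr zero    f n = refl
∑₁-foldr (suc N) f n =
  trans (ℤ.+-comm (∑₁ N f n) (f (suc N) n)) (cong (ℤ._+_ (f (suc N) n)) (∑₁-foldr N f n))

∑₁-sumsTo : ∀ (f : ℕ → Series) → (∀ {m n} → 1 ≤ m → n < m → f m n ≡ 0ℤ) →
            SumsTo (1 ≤_) f (λ n → ∑₁ n f n)
∑₁-sumsTo f vanishes n =
    applyDownFrom suc n
  , Unique.applyDownFrom⁺₁ suc n (λ j<i _ eq → ℕ.<⇒≢ j<i (sym (ℕ.suc-injective eq)))
  , All.applyDownFrom⁺₂ suc n (λ _ → s≤s z≤n)
  , (λ { (suc m) 1≤m m∉ → vanishes 1≤m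
           (ℕ.≰⇒> λ m<n → m∉ (∈.∈-applyDownFrom⁺ suc m<n)) })
  , ∑₁-foldr n f n

mainTheorem8 : ∃ λ (S : Series) →
    SumsTo EON (λ π → q^ (weight π)) S ×
    SumsTo (λ m → 1 ≤ m)
    (λ m → recip (qPoch m) ⊛ (q^ m ⊕ ∑₁ (m ∸ 1) (λ k → q^ (k * m ∸ (k C 2))))) S
-- The coefficient of q^n is taken from the n-th partial sum, since the terms with m > n do not
-- reach it.
mainTheorem8 = (λ n → ∑₁ n term n)
  , enumerated⇒sumsTo EON-weight-enumerated
  , ∑₁-sumsTo term term-vanishes
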